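{- Let $\mathcal{R}$ be a finite valuation ring with residue field of cardinality $q$ and with uniformizer of nilpotency degree $r$ (so $|\mathcal{R}|=q^r$), and let $\mathcal{R}^*$ denote its group of units. Let $g\colon\mathcal{R}^*\to\mathcal{R}^*$ be a function and let $K\ge1$ be such that $\mu(\psi)\le K$, where $\psi\colon\mathcal{R}^*\to\mathcal{R}$, $\psi(x)=g(x)^2x$. Let $f(x,y)=xy(g(x)+y)$. Then there is a constant $c>0$ depending only on $r$ and $K$ such that for all $A,B,C\subset\mathcal{R}^*$, \[|f(A,B)|\,|B\cdot C|\ \ge\ c\min\left\{q^r|B|,\ \frac{|A||B|^2|C|}{q^{2r-1}}\right\}.\]
   Context: A finite valuation ring is a finite commutative ring with identity that is local (has a unique maximal ideal) and principal (every ideal is principal); its maximal ideal is generated by a non-unit $z$ (a uniformizer), the residue field $\mathcal{R}/(z)$ has $q$ elements, and $r$ is the least integer with $z^r=0$. For a function $\varphi\colon\mathcal{R}^*\to\mathcal{R}$, $\mu(\varphi)=\max_{t\in\mathcal{R}}|\{x\in\mathcal{R}^*:\varphi(x)=t\}|$. Notation: $f(A,B)=\{f(x,y):x\in A,y\in B\}$, $B\cdot C=\{bc:b\in B,c\in C\}$. -}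

module Defs where

open import Algebra.Bundles using (CommutativeRing)
open import Algebra.Definitions using (Invertible)
import Algebra.Properties.Ring as RingProperties
import Algebra.Properties.Semiring.Divisibility as Divisibility
import Algebra.Properties.Semiring.Exp as Exponentiation
open import Data.Fin.Base using (Fin)
open import Data.Fin.Properties using (any?; nonZeroIndex) renaming (_≟_ to _≟ᶠ_)
open import Data.List.Base using (List; allFin; map; mapMaybe; filter; length; deduplicate; cartesianProductWith)
open import Data.List.Extrema.Nat using (max)
import Data.Maybe.Base as Maybe
open import Data.Nat.Base using (ℕ; NonZero) renaming (_<_ to _<ℕ_)
open import Data.Product.Base using (Σ-syntax; ∃-syntax; _×_; _,_; proj₁)
open import Function.Bundles using (Func; Inverse)
open import Function.Properties.Inverse using (Inverse⇒Injection)
open import Level using (Level; _⊔_; suc)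
open import Relation.Binary.Bundles using (Setoid; DecSetoid)
open import Relation.Binary.Definitions using (Decidable; _Respects_)
import Relation.Binary.Construct.On as On
open import Relation.Binary.PropositionalEquality using (setoid)
open import Relation.Nullary.Decidable using (map′; via-injection; dec⇒maybe; _×-dec_)
open import Relation.Nullary.Negation using (¬_)
open import Relation.Unary using (Pred; _∈_; _∉_; _⊆_; _≐_) renaming (Decidable to Decidable₁)

infix 4 _HasCardinality_

_HasCardinality_ : ∀ {a ℓ} → Setoid a ℓ → ℕ → Set (a ⊔ ℓ)
S HasCardinality n = Inverse S (setoid (Fin n))

-- A finite subset of S is presented by a list of its elements, in any order and
-- possibly with repetitions; its cardinality counts the distinct elements.
cardinality : ∀ {a ℓ} (S : DecSetoid a ℓ) → List (DecSetoid.Carrier S) → ℕ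
cardinality S xs = length (deduplicate (DecSetoid._≟_ S) xs)

module _ {a ℓ : Level} (R : CommutativeRing a ℓ) where
  open CommutativeRing R renaming (setoid to ≈-setoid)
  open Divisibility semiring using (_∣_; _,_)
  open Exponentiation semiring using (_^_)
  open RingProperties ring using (-‿+-comm; -‿involutive; -‿distribˡ-*)

  -- Classically every subset of a finite ring is decidable. Constructively it has
  -- to be required: if an undecidable subset {x | x ≈ 0 or P} could be an ideal,
  -- then being principal would decide the arbitrary proposition P.
  record Ideal : Set (suc (a ⊔ ℓ)) where
    field
      member    : Pred Carrier (a ⊔ ℓ)
      member?   : Decidable₁ member
      resp      : member Respects _≈_
      0∈        : 0# ∈ member
      +-closed  : ∀ {x y} → x ∈ member → y ∈ member → (x + y) ∈ member
      *-closed  : ∀ x {y} → y ∈ member → (x * y) ∈ member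

  open Ideal using (member)

  IsMaximal : Ideal → Set (suc (a ⊔ ℓ))
  IsMaximal I = 1# ∉ member I ×
    (∀ (J : Ideal) → member I ⊆ member J → 1# ∉ member J → member J ⊆ member I)

  IsLocal : Set (suc (a ⊔ ℓ))
  IsLocal = Σ[ M ∈ Ideal ] IsMaximal M × (∀ (N : Ideal) → IsMaximal N → member N ≐ member M)

  Generates : Carrier → Ideal → Set (a ⊔ ℓ)
  Generates z I = member I ≐ (z ∣_)

  IsPrincipal : Set (suc (a ⊔ ℓ))
  IsPrincipal = ∀ (I : Ideal) → ∃[ z ] Generates z I

  -- The underlying setoid of the quotient ring R/(z).
  quotient : Carrier → Setoid a (a ⊔ ℓ)
  quotient z = record
    { Carrier = Carrier
    ; _≈_ = λ x y → z ∣ (x - y)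
    ; isEquivalence = record
      { refl  = λ {x} → 0# , trans (zeroˡ z) (sym (-‿inverseʳ x))
      ; sym   = λ { {x} {y} (k , kz≈x-y) → - k ,
          trans (sym (-‿distribˡ-* k z))
            (trans (-‿cong kz≈x-y)
              (trans (sym (-‿+-comm x (- y)))
                (trans (+-comm (- x) (- (- y))) (+-congʳ (-‿involutive y))))) }
      ; trans = λ { {w} {x} {y} (k , kz≈w-x) (l , lz≈x-y) → k + l ,
          trans (distribʳ z k l)
            (trans (+-cong kz≈w-x lz≈x-y)
              (trans (+-assoc w (- x) (x - y))
                (+-congˡ (trans (sym (+-assoc (- x) x (- y)))
                  (trans (+-congʳ (-‿inverseˡ x)) (+-identityˡ (- y))))))) }
      }
    }

  IsNilpotencyDegree : Carrier → ℕ → Set ℓ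
  IsNilpotencyDegree z r = (z ^ r ≈ 0#) × (∀ m → m <ℕ r → ¬ (z ^ m ≈ 0#))

  IsUnit : Pred Carrier (a ⊔ ℓ)
  IsUnit = Invertible _≈_ 1# _*_

record FiniteValuationRing (a ℓ : Level) : Set (suc (a ⊔ ℓ)) where
  field
    commutativeRing : CommutativeRing a ℓ

  open CommutativeRing commutativeRing using (Carrier) public
  open CommutativeRing commutativeRing hiding (Carrier) renaming (setoid to ≈-setoid)

  field
    order       : ℕ
    finite      : ≈-setoid HasCardinality order
    isLocal     : IsLocal commutativeRing
    isPrincipal : IsPrincipal commutativeRing

  maximalIdeal : Ideal commutativeRing
  maximalIdeal = proj₁ isLocal

  IsUniformizer : Carrier → Set (a ⊔ ℓ)
  IsUniformizer z = Generates commutativeRing z maximalIdeal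

  private
    module F = Inverse finite

  _≟_ : Decidable _≈_
  _≟_ = via-injection (Inverse⇒Injection finite) _≟ᶠ_

  ≈-decSetoid : DecSetoid a ℓ
  ≈-decSetoid = record
    { isDecEquivalence = record { isEquivalence = isEquivalence ; _≟_ = _≟_ } }

  Unit : Set (a ⊔ ℓ)
  Unit = Σ[ x ∈ Carrier ] IsUnit commutativeRing x

  val : Unit → Carrier
  val = proj₁

  Unit-decSetoid : DecSetoid (a ⊔ ℓ) ℓ
  Unit-decSetoid = On.decSetoid ≈-decSetoid val

  Unit-setoid : Setoid (a ⊔ ℓ) ℓ
  Unit-setoid = DecSetoid.setoid Unit-decSetoid

  unit? : Decidable₁ (IsUnit commutativeRing)
  unit? x = map′
    (λ (i , yx≈1 , xy≈1) → F.from i , yx≈1 , xy≈1)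
    (λ (y , yx≈1 , xy≈1) → let y′≈y = F.strictlyInverseʳ y in
      F.to y , trans (*-congʳ y′≈y) yx≈1 , trans (*-congˡ y′≈y) xy≈1)
    (any? λ i → ((F.from i * x) ≟ 1#) ×-dec ((x * F.from i) ≟ 1#))

  elements : List Carrier
  elements = map F.from (allFin order)

  -- Every unit occurs here exactly once up to the equality of Unit-setoid.
  units : List Unit
  units = mapMaybe (λ x → Maybe.map (x ,_) (dec⇒maybe (unit? x))) elements

  μ : Func Unit-setoid ≈-setoid → ℕ
  μ φ = max 0 (map (λ t → length (filter (λ x → Func.to φ x ≟ t) units)) elements)

  ∣_∣ : List Carrier → ℕ
  ∣_∣ = cardinality ≈-decSetoid

  ∣_∣ₓ : List Unit → ℕ
  ∣_∣ₓ = cardinality Unit-decSetoid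

  infixl 7 _·_

  _·_ : List Unit → List Unit → List Carrier
  _·_ = cartesianProductWith λ b c → val b * val c

  module _ (g : Func Unit-setoid Unit-setoid) where
    private
      g′ : Unit → Carrier
      g′ x = val (Func.to g x)

    ψ : Func Unit-setoid ≈-setoid
    ψ = record
      { to   = λ x → (g′ x * g′ x) * val x
      ; cong = λ {x} {y} x≈y →
          let gx≈gy = Func.cong g {x} {y} x≈y in *-cong (*-cong gx≈gy gx≈gy) x≈y
      }

    f : Unit → Unit → Carrier
    f x y = (val x * val y) * (g′ x + val y)

    f[_,_] : List Unit → List Unit → List Carrier
    f[_,_] = cartesianProductWith f

residue-nonZero : ∀ {a ℓ} (R : CommutativeRing a ℓ) {z : CommutativeRing.Carrier R} {q : ℕ} →
                  quotient R z HasCardinality q → NonZero q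
residue-nonZero R q-elements = nonZeroIndex (Inverse.to q-elements (CommutativeRing.0# R))

{-# OPTIONS --safe #-}

-- The pair (x , c) ∈ A × C determines the line (m , k) = (x g(x) / c , x / c²), and this line passes
-- through the point (s , t) = (b c , f(x , b)) of BC × f(A , B) for each b ∈ B, where incidence means
-- m s + k s² = t. A line arises from at most K pairs: m² / k = ψ(x), and then x and m determine c.
-- On the other side, the number i of incidences of a line with the p = |BC| |f(A , B)| points has mean
-- p / |R| over all of R², and second moment at most (p² + p |R| |(z)|) / |R|²: distinct points share at
-- most one line unless their s-coordinates agree modulo z, and for a fixed point the pairs of a line
-- through it and a second, congruent point on that line number at most |R| |(z)| = q²ʳ⁻¹. So if
-- q^r |B| ≥ 2 p, every line with i ≥ |B| exceeds the mean by |B| / 2, and Chebyshev's inequality gives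
-- |A| |B|² |C| ≤ 4 K p q²ʳ⁻¹.
module Submission where

open import Defs
open import Algebra.Bundles using (CommutativeRing)
import Algebra.Properties.Ring as RingProperties
import Algebra.Properties.Semiring.Divisibility as Divisibility
import Algebra.Properties.Semiring.Exp as Exponentiation
import Algebra.Solver.Ring.NaturalCoefficients.Default as SemiringSolver
open import Data.Empty using (⊥-elim)
open import Data.Fin.Base using (Fin)
open import Data.Fin.Properties using (any?; nonZeroIndex)
import Data.Integer.Base as ℤ
import Data.Integer.Properties as ℤ
open import Data.List.Base using (List; []; _∷_; [_]; _++_; allFin; cartesianProduct; cartesianProductWith; deduplicate; filter; length; map)
open import Data.List.Extrema.Nat using (xs≤max)
open import Data.List.Membership.Propositional using (_∈_; find; lose)
open import Data.List.Membership.Propositional.Properties using (∈-allFin; ∈-cartesianProduct⁺; ∈-cartesianProduct⁻; ∈-cartesianProductWith⁺; ∈-cartesianProductWith⁻; ∈-map⁺)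
open import Data.List.Properties using (length-++; length-map; length-tabulate; map-++; map-cong; map-∘)
open import Data.List.Relation.Unary.All as All using ([])
open import Data.List.Relation.Unary.AllPairs using ([]; _∷_)
open import Data.List.Relation.Unary.Any as Any using (here; there)
import Data.List.Relation.Unary.Any.Properties as AnyProperties
import Data.List.Relation.Unary.Unique.DecSetoid.Properties as UniqueDecProperties
open import Data.List.Relation.Unary.Unique.Propositional.Properties using (allFin⁺)
open import Data.List.Relation.Unary.Unique.Setoid using (Unique)
import Data.List.Relation.Unary.Unique.Setoid.Properties as UniqueProperties
import Data.Maybe.Base as Maybe
import Data.Maybe.Relation.Unary.Any as MaybeAny
open import Data.Nat.Base as ℕ using (ℕ; zero; suc; _≤_; z≤n; s≤s)
open import Data.Nat.ListAction using (sum)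
open import Data.Nat.ListAction.Properties using (sum-++)
import Data.Nat.Properties as ℕ
open import Data.Nat.Tactic.RingSolver using (solve-∀)
open import Data.Product.Base using (∃-syntax; _×_; _,_; proj₁; proj₂)
open import Data.Product.Relation.Binary.Pointwise.NonDependent using (_×ₛ_)
import Data.Rational.Properties as ℚ
open import Data.Rational.Unnormalised.Base as ℚᵘ using (mkℚᵘ; *≤*)
import Data.Rational.Unnormalised.Properties as ℚᵘ
open import Data.Sum.Base using (_⊎_; inj₁; inj₂)
open import Data.Unit.Base using (tt)
open import Function.Base using (_∘_; id)
open import Function.Bundles using (Func; Inverse)
open import Level using (Level; _⊔_)
open import Relation.Binary.Bundles using (DecSetoid; Setoid)
import Relation.Binary.Construct.On as On
open import Relation.Binary.PropositionalEquality as ≡ using (_≡_)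
open import Relation.Nullary.Decidable using (Dec; yes; no; map′; _×-dec_; dec⇒maybe)
open import Relation.Nullary.Negation.Core using (¬_)

-- Sums of indicators over lists, double counting and a second-moment inequality.

module Counting where

  open import Data.Nat.Base using (ℕ; zero; suc; NonZero; _+_; _*_; _≤_; z≤n; s≤s)
  open import Data.Nat.Properties
  open ≡ using (_≡_; refl; sym; trans; cong; cong₂; subst; subst₂; module ≡-Reasoning)

  private
    variable
      a b p q ℓ : Level
      A B : Set a

  ⟦_⟧ : {P : Set p} → Dec P → ℕ
  ⟦ yes _ ⟧ = 1
  ⟦ no  _ ⟧ = 0

  ⟦⟧-× : {P : Set p} {Q : Set q} (P? : Dec P) (Q? : Dec Q) → ⟦ P? ×-dec Q? ⟧ ≡ ⟦ P? ⟧ * ⟦ Q? ⟧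
  ⟦⟧-× (yes _) (yes _) = refl
  ⟦⟧-× (yes _) (no _)  = refl
  ⟦⟧-× (no _)  _       = refl

  ⟦⟧-true : {P : Set p} (P? : Dec P) → P → ⟦ P? ⟧ ≡ 1
  ⟦⟧-true (yes _) _ = refl
  ⟦⟧-true (no ¬p) p = ⊥-elim (¬p p)

  ⟦⟧-mono : {P : Set p} {Q : Set q} (P? : Dec P) (Q? : Dec Q) → (P → Q) → ⟦ P? ⟧ ≤ ⟦ Q? ⟧
  ⟦⟧-mono (yes p) Q? P⇒Q = ≤-reflexive (sym (⟦⟧-true Q? (P⇒Q p)))
  ⟦⟧-mono (no _)  Q? P⇒Q = z≤n

  ∑ : List A → (A → ℕ) → ℕ
  ∑ xs f = sum (map f xs)

  syntax ∑ xs (λ x → e) = ∑[ x ← xs ] e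

  ∑-mono : ∀ (xs : List A) {f g : A → ℕ} → (∀ {x} → x ∈ xs → f x ≤ g x) → ∑ xs f ≤ ∑ xs g
  ∑-mono []       f≤g = z≤n
  ∑-mono (x ∷ xs) f≤g = +-mono-≤ (f≤g (here refl)) (∑-mono xs (f≤g ∘ there))

  ∑-cong : ∀ (xs : List A) {f g : A → ℕ} → (∀ x → f x ≡ g x) → ∑ xs f ≡ ∑ xs g
  ∑-cong xs f≡g = cong sum (map-cong f≡g xs)

  f≤∑ : ∀ (f : A → ℕ) {x xs} → x ∈ xs → f x ≤ ∑ xs f
  f≤∑ f {xs = x ∷ xs} (here refl)  = m≤m+n (f x) (∑ xs f)
  f≤∑ f {xs = x ∷ xs} (there x∈xs) = ≤-trans (f≤∑ f x∈xs) (m≤n+m (∑ xs f) (f x))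

  ∑-const : ∀ (xs : List A) n → ∑[ _ ← xs ] n ≡ length xs * n
  ∑-const []       n = refl
  ∑-const (x ∷ xs) n = cong (n +_) (∑-const xs n)

  ∑-≤-const : ∀ (xs : List A) {f : A → ℕ} {n} → (∀ {x} → x ∈ xs → f x ≤ n) → ∑ xs f ≤ length xs * n
  ∑-≤-const xs f≤n = ≤-trans (∑-mono xs f≤n) (≤-reflexive (∑-const xs _))

  const-≤-∑ : ∀ (xs : List A) {f : A → ℕ} {n} → (∀ {x} → x ∈ xs → n ≤ f x) → length xs * n ≤ ∑ xs f
  const-≤-∑ xs n≤f = ≤-trans (≤-reflexive (sym (∑-const xs _))) (∑-mono xs n≤f)

  ∑-+ : ∀ (xs : List A) {f g : A → ℕ} → ∑[ x ← xs ] (f x + g x) ≡ ∑ xs f + ∑ xs g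
  ∑-+ []               = refl
  ∑-+ (x ∷ xs) {f} {g} = begin
    f x + g x + ∑[ y ← xs ] (f y + g y)  ≡⟨ cong (f x + g x +_) (∑-+ xs) ⟩
    f x + g x + (∑ xs f + ∑ xs g)        ≡⟨ interchange (f x) (g x) (∑ xs f) (∑ xs g) ⟩
    f x + ∑ xs f + (g x + ∑ xs g)        ∎
    where
    open ≡-Reasoning
    interchange : ∀ i j k l → i + j + (k + l) ≡ i + k + (j + l)
    interchange = solve-∀

  ∑-*ˡ : ∀ (xs : List A) n {f : A → ℕ} → ∑[ x ← xs ] (n * f x) ≡ n * ∑ xs f
  ∑-*ˡ []       n     = sym (*-zeroʳ n)
  ∑-*ˡ (x ∷ xs) n {f} = trans (cong (n * f x +_) (∑-*ˡ xs n)) (sym (*-distribˡ-+ n (f x) (∑ xs f)))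

  ∑-*ʳ : ∀ (xs : List A) n {f : A → ℕ} → ∑[ x ← xs ] (f x * n) ≡ ∑ xs f * n
  ∑-*ʳ xs n {f} = trans (∑-cong xs λ x → *-comm (f x) n) (trans (∑-*ˡ xs n) (*-comm n (∑ xs f)))

  ∑-swap : ∀ (xs : List A) (ys : List B) (f : A → B → ℕ) →
           ∑[ x ← xs ] ∑[ y ← ys ] f x y ≡ ∑[ y ← ys ] ∑[ x ← xs ] f x y
  ∑-swap []       ys f = sym (trans (∑-const ys 0) (*-zeroʳ (length ys)))
  ∑-swap (x ∷ xs) ys f = trans (cong (∑ ys (f x) +_) (∑-swap xs ys f)) (sym (∑-+ ys))

  ∑-cartesianProduct : ∀ (xs : List A) (ys : List B) (f : A × B → ℕ) →
                       ∑ (cartesianProduct xs ys) f ≡ ∑[ x ← xs ] ∑[ y ← ys ] f (x , y)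
  ∑-cartesianProduct []       ys f = refl
  ∑-cartesianProduct (x ∷ xs) ys f = begin
    sum (map f (map (x ,_) ys ++ cartesianProduct xs ys))
      ≡⟨ cong sum (map-++ f (map (x ,_) ys) (cartesianProduct xs ys)) ⟩
    sum (map f (map (x ,_) ys) ++ map f (cartesianProduct xs ys))
      ≡⟨ sum-++ (map f (map (x ,_) ys)) _ ⟩
    sum (map f (map (x ,_) ys)) + ∑ (cartesianProduct xs ys) f
      ≡⟨ cong₂ _+_ (cong sum (sym (map-∘ ys))) (∑-cartesianProduct xs ys f) ⟩
    ∑[ y ← ys ] f (x , y) + ∑[ x′ ← xs ] ∑[ y ← ys ] f (x′ , y) ∎
    where open ≡-Reasoning

  ∑-⟦⟧-none : {P : A → Set p} (P? : ∀ x → Dec (P x)) (xs : List A) →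
              (∀ {x} → x ∈ xs → ¬ P x) → ∑[ x ← xs ] ⟦ P? x ⟧ ≡ 0
  ∑-⟦⟧-none P? []       none = refl
  ∑-⟦⟧-none P? (x ∷ xs) none with P? x
  ... | yes px = ⊥-elim (none (here refl) px)
  ... | no  _  = ∑-⟦⟧-none P? xs (none ∘ there)

  ∑-⟦⟧-filter : {P : A → Set p} (P? : ∀ x → Dec (P x)) (xs : List A) →
                ∑[ x ← xs ] ⟦ P? x ⟧ ≡ length (filter P? xs)
  ∑-⟦⟧-filter P? []       = refl
  ∑-⟦⟧-filter P? (x ∷ xs) with P? x
  ... | yes _ = cong suc (∑-⟦⟧-filter P? xs)
  ... | no  _ = ∑-⟦⟧-filter P? xs

  ∑-1 : ∀ (xs : List A) → ∑[ _ ← xs ] 1 ≡ length xs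
  ∑-1 xs = trans (∑-const xs 1) (*-identityʳ (length xs))

  module _ (S : Setoid a ℓ) where
    open Setoid S using (Carrier; _≈_)

    -- The bound is `⟦ Q? ⟧` instead of 1 so that, in double counting, it can be summed over a
    -- second index on which `Q` depends.
    ∑-⟦⟧-atMostOne : {P : Carrier → Set p} {Q : Set q} (P? : ∀ x → Dec (P x)) (Q? : Dec Q) →
                     ∀ {xs} → Unique S xs →
                     (∀ {x x′} → P x → P x′ → x ≈ x′) → (∀ {x} → P x → Q) →
                     ∑[ x ← xs ] ⟦ P? x ⟧ ≤ ⟦ Q? ⟧
    ∑-⟦⟧-atMostOne P? Q? {[]}     []           P-unique P⇒Q = z≤n
    ∑-⟦⟧-atMostOne P? Q? {x ∷ xs} (x∉xs ∷ xs!) P-unique P⇒Q with P? x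
    ... | no _   = ∑-⟦⟧-atMostOne P? Q? xs! P-unique P⇒Q
    ... | yes px = ≤-reflexive (trans
      (cong suc (∑-⟦⟧-none P? xs λ y∈xs py → All.lookup x∉xs y∈xs (P-unique px py)))
      (sym (⟦⟧-true Q? (P⇒Q px))))

    -- Double counting of a relation that embeds {x ∈ xs | P x} into {y ∈ ys | Q y}.
    ∑-⟦⟧-≤ : ∀ {r} {P : Carrier → Set p} {Q : B → Set q} {R : Carrier → B → Set r}
             (P? : ∀ x → Dec (P x)) (Q? : ∀ y → Dec (Q y)) (R? : ∀ x y → Dec (R x y)) →
             ∀ {xs} → Unique S xs → (ys : List B) →
             (∀ {x} → x ∈ xs → P x → ∃[ y ] y ∈ ys × R x y) →
             (∀ {x x′ y} → P x → P x′ → R x y → R x′ y → x ≈ x′) →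
             (∀ {x y} → P x → R x y → Q y) →
             ∑[ x ← xs ] ⟦ P? x ⟧ ≤ ∑[ y ← ys ] ⟦ Q? y ⟧
    ∑-⟦⟧-≤ {P = P} {R = R} P? Q? R? {xs} xs! ys total injective P∧R⇒Q = begin
      ∑[ x ← xs ] ⟦ P? x ⟧                             ≤⟨ ∑-mono xs related ⟩
      ∑[ x ← xs ] ∑[ y ← ys ] ⟦ P? x ×-dec R? x y ⟧    ≡⟨ ∑-swap xs ys _ ⟩
      ∑[ y ← ys ] ∑[ x ← xs ] ⟦ P? x ×-dec R? x y ⟧    ≤⟨ ∑-mono ys (λ {y} _ →
        ∑-⟦⟧-atMostOne (λ x → P? x ×-dec R? x y) (Q? y) xs!
          (λ { (px , rxy) (px′ , rx′y) → injective px px′ rxy rx′y })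
          (λ { (px , rxy) → P∧R⇒Q px rxy })) ⟩
      ∑[ y ← ys ] ⟦ Q? y ⟧                             ∎
      where
      open ≤-Reasoning
      related : ∀ {x} → x ∈ xs → ⟦ P? x ⟧ ≤ ∑[ y ← ys ] ⟦ P? x ×-dec R? x y ⟧
      related {x} x∈xs with P? x
      ... | no _   = z≤n
      ... | yes px with total x∈xs px
      ...   | y , y∈ys , rxy = ≤-trans
        (≤-reflexive (sym (⟦⟧-true (yes px ×-dec R? x y) (px , rxy))))
        (f≤∑ (λ y → ⟦ yes px ×-dec R? x y ⟧) y∈ys)

    length-≤ : ∀ {r} {R : Carrier → B → Set r} (R? : ∀ x y → Dec (R x y)) →
               ∀ {xs} → Unique S xs → (ys : List B) →
               (∀ x → ∃[ y ] y ∈ ys × R x y) →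
               (∀ {x x′ y} → R x y → R x′ y → x ≈ x′) →
               length xs ≤ length ys
    length-≤ R? {xs} xs! ys total injective = subst₂ _≤_ (∑-1 xs) (∑-1 ys)
      (∑-⟦⟧-≤ (λ _ → yes tt) (λ _ → yes tt) R? xs! ys
        (λ {x} _ _ → total x) (λ _ _ → injective) _)

  -- (u - v)² ≥ β² with the terms moved so that no subtraction occurs.
  separated : ∀ {β u v} → β + v ≤ u → β * β + 2 * v * u ≤ u * u + v * v
  separated {β} {u} {v} β+v≤u with m≤n⇒∃[o]m+o≡n β+v≤u
  ... | d , refl = subst (β * β + 2 * v * (β + v + d) ≤_) (expand β v d) (m≤m+n _ _)
    where
    expand : ∀ β v d → β * β + 2 * v * (β + v + d) + (2 * β * d + d * d) ≡
                       (β + v + d) * (β + v + d) + v * v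
    expand = solve-∀

  2vu≤u²+v² : ∀ u v → 2 * v * u ≤ u * u + v * v
  2vu≤u²+v² u v with ≤-total v u
  ... | inj₁ v≤u = separated {0} v≤u
  -- With gap `β` = 0, `separated` is symmetric in its two arguments, so they may be exchanged.
  ... | inj₂ u≤v = subst₂ _≤_ (comm u v) (+-comm (v * v) (u * u)) (separated {0} u≤v)
    where
    comm : ∀ u v → 2 * u * v ≡ 2 * v * u
    comm = solve-∀

  module _ {X : Set a} {Y : Set b} (points : List X) (lines : List Y) (e : X → Y → ℕ) where

    private
      P = length points
      i : Y → ℕ
      i l = ∑[ p ← points ] e p l

    ∑-square : ∑[ l ← lines ] (i l * i l) ≡ ∑[ p ← points ] ∑[ p′ ← points ] ∑[ l ← lines ] (e p l * e p′ l)
    ∑-square = begin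
      ∑[ l ← lines ] (i l * i l)
        ≡⟨ ∑-cong lines (λ l → trans (sym (∑-*ʳ points (i l)))
             (∑-cong points λ p → sym (∑-*ˡ points (e p l)))) ⟩
      ∑[ l ← lines ] ∑[ p ← points ] ∑[ p′ ← points ] (e p l * e p′ l)
        ≡⟨ ∑-swap lines points _ ⟩
      ∑[ p ← points ] ∑[ l ← lines ] ∑[ p′ ← points ] (e p l * e p′ l)
        ≡⟨ ∑-cong points (λ p → ∑-swap lines points _) ⟩
      ∑[ p ← points ] ∑[ p′ ← points ] ∑[ l ← lines ] (e p l * e p′ l) ∎
      where open ≡-Reasoning

    -- Chebyshev's inequality for i, whose mean over the N² lines is P / N.
    rich-lines : ∀ {N D K β} .{{_ : NonZero N}} (w : Y → ℕ) →
      length lines ≡ N * N →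
      (∀ {p} → p ∈ points → N ≤ ∑[ l ← lines ] e p l) →
      (∀ {p} → p ∈ points → ∑[ p′ ← points ] ∑[ l ← lines ] (e p l * e p′ l) ≤ P + D) →
      (∀ l → w l ≤ K) → (∀ l → 1 ≤ w l → β ≤ i l) →
      2 * P ≤ N * β →
      ∑ lines w * (β * β) ≤ 4 * K * P * D
    rich-lines {N} {D} {K} {β} w ∣lines∣ first second w≤K rich 2P≤Nβ =
      -- The inequality summed over lines is w (Nβ)² ≤ K (2N i - 2P)². Its cross term 8KNP i stays
      -- on the left, and by `first` its sum is at least 8KN²P². Adding that amount to both sides
      -- replaces the subtraction, and N² cancels at the end.
      *-cancelˡ-≤ (N * N) {{m*n≢0 N N}} (+-cancelʳ-≤ (8 * K * N * N * P * P) _ _ (begin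
        N * N * (∑ lines w * (β * β)) + 8 * K * N * N * P * P
          ≡⟨ lhs-eq N K P β (∑ lines w) ⟩
        ∑ lines w * (N * β * (N * β)) + 8 * K * N * P * (P * N)
          ≤⟨ +-monoʳ-≤ (∑ lines w * (N * β * (N * β)))
               (*-monoʳ-≤ (8 * K * N * P) (const-≤-∑ points first)) ⟩
        ∑ lines w * (N * β * (N * β)) + 8 * K * N * P * ∑[ p ← points ] ∑[ l ← lines ] e p l
          ≡⟨ cong (λ n → ∑ lines w * (N * β * (N * β)) + 8 * K * N * P * n) (∑-swap points lines e) ⟩
        ∑ lines w * (N * β * (N * β)) + 8 * K * N * P * ∑ lines i
          ≡⟨ sym (trans (∑-+ lines) (cong₂ _+_ (∑-*ʳ lines _) (∑-*ˡ lines (8 * K * N * P)))) ⟩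
        ∑[ l ← lines ] (w l * (N * β * (N * β)) + 8 * K * N * P * i l)
          ≤⟨ ∑-mono lines (λ {l} _ → pointwise l) ⟩
        ∑[ l ← lines ] (4 * K * N * N * (i l * i l) + 4 * K * P * P)
          ≡⟨ trans (∑-+ lines) (cong₂ _+_ (∑-*ˡ lines (4 * K * N * N)) (∑-const lines _)) ⟩
        4 * K * N * N * ∑[ l ← lines ] (i l * i l) + length lines * (4 * K * P * P)
          ≡⟨ cong₂ (λ m n → 4 * K * N * N * m + n * (4 * K * P * P)) ∑-square ∣lines∣ ⟩
        4 * K * N * N * ∑[ p ← points ] ∑[ p′ ← points ] ∑[ l ← lines ] (e p l * e p′ l)
          + N * N * (4 * K * P * P)
          ≤⟨ +-monoˡ-≤ _ (*-monoʳ-≤ (4 * K * N * N) (∑-≤-const points second)) ⟩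
        4 * K * N * N * (P * (P + D)) + N * N * (4 * K * P * P)
          ≡⟨ rhs-eq N K P D ⟩
        N * N * (4 * K * P * D) + 8 * K * N * N * P * P ∎))
      where
      open ≤-Reasoning
      lhs-eq : ∀ N K P β W → N * N * (W * (β * β)) + 8 * K * N * N * P * P ≡
                             W * (N * β * (N * β)) + 8 * K * N * P * (P * N)
      lhs-eq = solve-∀
      rhs-eq : ∀ N K P D → 4 * K * N * N * (P * (P + D)) + N * N * (4 * K * P * P) ≡
                           N * N * (4 * K * P * D) + 8 * K * N * N * P * P
      rhs-eq = solve-∀
      split : ∀ N K P i γ → K * γ + 8 * K * N * P * i ≡ K * (γ + 2 * (2 * P) * (2 * N * i))
      split = solve-∀
      join : ∀ N K P i → K * (2 * N * i * (2 * N * i) + 2 * P * (2 * P)) ≡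
                         4 * K * N * N * (i * i) + 4 * K * P * P
      join = solve-∀
      double : ∀ N m → N * m + N * m ≡ 2 * N * m
      double = solve-∀

      scaled : ∀ {γ} l → γ + 2 * (2 * P) * (2 * N * i l) ≤ 2 * N * i l * (2 * N * i l) + 2 * P * (2 * P) →
               K * γ + 8 * K * N * P * i l ≤ 4 * K * N * N * (i l * i l) + 4 * K * P * P
      scaled {γ} l γ≤ = subst₂ _≤_ (sym (split N K P (i l) γ)) (join N K P (i l)) (*-monoʳ-≤ K γ≤)

      -- A line of weight 0 only needs (2N i - 2P)² ≥ 0. A line of positive weight has i ≥ β, so 2N
      -- i - 2P ≥ 2Nβ - Nβ = Nβ, and its weight is at most K.
      pointwise : ∀ l → w l * (N * β * (N * β)) + 8 * K * N * P * i l ≤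
                        4 * K * N * N * (i l * i l) + 4 * K * P * P
      pointwise l with w l | w≤K l | rich l
      ... | zero  | _   | _    = subst (_≤ 4 * K * N * N * (i l * i l) + 4 * K * P * P)
        (cong (_+ 8 * K * N * P * i l) (*-zeroʳ K)) (scaled l (2vu≤u²+v² (2 * N * i l) (2 * P)))
      ... | suc n | n<K | β≤i = ≤-trans (+-monoˡ-≤ _ (*-monoˡ-≤ (N * β * (N * β)) n<K))
        (scaled l (separated {N * β} {v = 2 * P} (begin
          N * β + 2 * P      ≤⟨ +-monoʳ-≤ (N * β) 2P≤Nβ ⟩
          N * β + N * β      ≡⟨ double N β ⟩
          2 * N * β          ≤⟨ *-monoʳ-≤ (2 * N) (β≤i (s≤s z≤n)) ⟩
          2 * N * i l        ∎)))

open Counting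

length-cartesianProductWith : ∀ {a b c} {A : Set a} {B : Set b} {C : Set c} (f : A → B → C) xs ys →
                              length (cartesianProductWith f xs ys) ≡ length xs ℕ.* length ys
length-cartesianProductWith f []       ys = ≡.refl
length-cartesianProductWith f (x ∷ xs) ys = ≡.trans (length-++ (map (f x) ys))
  (≡.cong₂ ℕ._+_ (length-map (f x) ys) (length-cartesianProductWith f xs ys))

-- Units and divisibility in a commutative ring.

module Units {a ℓ : Level} (R : CommutativeRing a ℓ) where
  open CommutativeRing R
  open Divisibility semiring using (_∣_; _,_)
  open SemiringSolver commutativeSemiring using (solve; _:=_; _:*_; _:+_)
  open import Relation.Binary.Reasoning.Setoid setoid

  inverse⇒unit : ∀ {x} y → y * x ≈ 1# → IsUnit R x
  inverse⇒unit {x} y yx≈1 = y , yx≈1 , trans (*-comm x y) yx≈1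

  unit-resp : ∀ {x y} → x ≈ y → IsUnit R x → IsUnit R y
  unit-resp x≈y (i , ix≈1 , _) = inverse⇒unit i (trans (*-congˡ (sym x≈y)) ix≈1)

  unit-* : ∀ {x y} → IsUnit R x → IsUnit R y → IsUnit R (x * y)
  unit-* {x} {y} (i , ix≈1 , _) (j , jy≈1 , _) = inverse⇒unit (i * j) (begin
    i * j * (x * y)    ≈⟨ solve 4 (λ i j x y → i :* j :* (x :* y) := i :* x :* (j :* y)) refl i j x y ⟩
    i * x * (j * y)    ≈⟨ *-cong ix≈1 jy≈1 ⟩
    1# * 1#            ≈⟨ *-identityˡ 1# ⟩
    1#                 ∎)

  unit-factorˡ : ∀ {x y} → IsUnit R (x * y) → IsUnit R x
  unit-factorˡ {x} {y} (i , ixy≈1 , _) = inverse⇒unit (i * y)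
    (trans (solve 3 (λ i x y → i :* y :* x := i :* (x :* y)) refl i x y) ixy≈1)

  unit-cancelˡ : ∀ {u x y} → IsUnit R u → u * x ≈ u * y → x ≈ y
  unit-cancelˡ {u} {x} {y} (i , iu≈1 , _) ux≈uy = begin
    x              ≈⟨ *-identityˡ x ⟨
    1# * x         ≈⟨ *-congʳ iu≈1 ⟨
    i * u * x      ≈⟨ *-assoc i u x ⟩
    i * (u * x)    ≈⟨ *-congˡ ux≈uy ⟩
    i * (u * y)    ≈⟨ *-assoc i u y ⟨
    i * u * y      ≈⟨ *-congʳ iu≈1 ⟩
    1# * y         ≈⟨ *-identityˡ y ⟩
    y              ∎

  unit-cancelʳ : ∀ {u x y} → IsUnit R u → x * u ≈ y * u → x ≈ y
  unit-cancelʳ {u} {x} {y} u-unit xu≈yu =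
    unit-cancelˡ u-unit (trans (*-comm u x) (trans xu≈yu (*-comm y u)))

  x-y+y≈x : ∀ x y → x - y + y ≈ x
  x-y+y≈x x y = trans (+-assoc x (- y) y) (trans (+-congˡ (-‿inverseˡ y)) (+-identityʳ x))

  ∣-difference⇒ : ∀ {z x y} → z ∣ (x - y) → ∃[ k ] x ≈ y + z * k
  ∣-difference⇒ {z} {x} {y} (k , kz≈x-y) = k , (begin
    x              ≈⟨ x-y+y≈x x y ⟨
    x - y + y      ≈⟨ +-comm (x - y) y ⟩
    y + (x - y)    ≈⟨ +-congˡ (trans (sym kz≈x-y) (*-comm k z)) ⟩
    y + z * k      ∎)

-- Structure of a finite valuation ring: non-units, z-adic digits and the order q^r.

module ValuationRing {a ℓ : Level} (V : FiniteValuationRing a ℓ)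
  {z : FiniteValuationRing.Carrier V} (z-uniformizer : FiniteValuationRing.IsUniformizer V z)
  {r q : ℕ} (z-nilpotent : IsNilpotencyDegree (FiniteValuationRing.commutativeRing V) z r)
  (residue : quotient (FiniteValuationRing.commutativeRing V) z HasCardinality q) where

  open FiniteValuationRing V hiding (∣_∣; _≟_)
  open FiniteValuationRing V public using (_≟_)
  open CommutativeRing commutativeRing public hiding (Carrier; zero) renaming (setoid to ≈-setoid)
  open RingProperties ring public using (+-cancelˡ; +-cancelʳ)
  open Divisibility semiring public using (_∣_; _,_)
  open Exponentiation semiring public using (_^_)
  open Units commutativeRing public
  open SemiringSolver commutativeSemiring public using (solve; _:=_; _:*_; _:+_)
  open import Relation.Binary.Reasoning.Setoid ≈-setoid
  open Ideal
  module F = Inverse finite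

  -- Propositional membership in `elements` holds for these representatives; an arbitrary element of
  -- the ring occurs there only up to `≈`.
  canonical : Carrier → Carrier
  canonical x = F.from (F.to x)

  canonical≈ : ∀ x → canonical x ≈ x
  canonical≈ = F.strictlyInverseʳ

  canonical∈ : ∀ x → canonical x ∈ elements
  canonical∈ x = ∈-map⁺ F.from (∈-allFin (F.to x))

  length-elements : length elements ≡ order
  length-elements = ≡.trans (length-map F.from (allFin order)) (length-tabulate id)

  elements-unique : Unique ≈-setoid elements
  elements-unique = UniqueProperties.map⁺ (≡.setoid (Fin order)) ≈-setoid
    (λ {i} {j} eq → ≡.trans (≡.sym (F.strictlyInverseˡ i)) (≡.trans (F.to-cong eq) (F.strictlyInverseˡ j)))
    (allFin⁺ order)

  z∣? : ∀ x → Dec (z ∣ x)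
  z∣? x = map′ (proj₁ z-uniformizer) (proj₂ z-uniformizer) (member? maximalIdeal x)

  z∤1 : ¬ z ∣ 1#
  z∤1 z∣1 = proj₁ (proj₁ (proj₂ isLocal)) (proj₂ z-uniformizer z∣1)

  z∣-*ˡ : ∀ y {x} → z ∣ x → z ∣ (y * x)
  z∣-*ˡ y (k , kz≈x) = y * k , trans (*-assoc y k z) (*-congˡ kz≈x)

  z∣-resp : ∀ {x y} → x ≈ y → z ∣ x → z ∣ y
  z∣-resp x≈y (k , kz≈x) = k , trans kz≈x x≈y

  unit⇒z∤ : ∀ {x} → IsUnit commutativeRing x → ¬ z ∣ x
  unit⇒z∤ (i , ix≈1 , _) z∣x = z∤1 (z∣-resp ix≈1 (z∣-*ˡ i z∣x))

  -- The decidability that `Ideal` demands comes from a search for both coefficients through the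
  -- finite ring.
  ⟨z,_⟩ : Carrier → Ideal commutativeRing
  ⟨z, x ⟩ = record
    { member   = λ y → ∃[ i ] ∃[ j ] i * z + j * x ≈ y
    ; member?  = λ y → map′
        (λ (m , n , eq) → F.from m , F.from n , eq)
        (λ (i , j , eq) → F.to i , F.to j ,
          trans (+-cong (*-congʳ (canonical≈ i)) (*-congʳ (canonical≈ j))) eq)
        (any? λ m → any? λ n → (F.from m * z + F.from n * x) ≟ y)
    ; resp     = λ { y≈y′ (i , j , eq) → i , j , trans eq y≈y′ }
    ; 0∈       = 0# , 0# , trans (+-cong (zeroˡ z) (zeroˡ x)) (+-identityˡ 0#)
    ; +-closed = λ { (i , j , eq) (k , l , eq′) → i + k , j + l , trans
        (solve 6 (λ i j k l z x → (i :+ k) :* z :+ (j :+ l) :* x :=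
                                  (i :* z :+ j :* x) :+ (k :* z :+ l :* x)) refl i j k l z x)
        (+-cong eq eq′) }
    ; *-closed = λ { y (i , j , eq) → y * i , y * j , trans
        (solve 5 (λ y i j z x → y :* i :* z :+ y :* j :* x := y :* (i :* z :+ j :* x)) refl y i j z x)
        (*-congˡ eq) }
    }

  -- If the ideal generated by z and x were proper, then, as it contains the maximal ideal (z),
  -- maximality would put x into (z).
  z∤⇒1∈⟨z,x⟩ : ∀ {x} → ¬ z ∣ x → member ⟨z, x ⟩ 1#
  z∤⇒1∈⟨z,x⟩ {x} z∤x with member? ⟨z, x ⟩ 1#
  ... | yes 1∈ = 1∈
  ... | no  1∉ = ⊥-elim (z∤x (proj₁ z-uniformizer
    (proj₂ (proj₁ (proj₂ isLocal)) ⟨z, x ⟩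
      (λ y∈M → let k , kz≈y = proj₁ z-uniformizer y∈M in
        k , 0# , trans (+-congˡ (zeroˡ x)) (trans (+-identityʳ (k * z)) kz≈y))
      1∉
      (0# , 1# , trans (+-cong (zeroˡ z) (*-identityˡ x)) (+-identityˡ x)))))

  z^r≈0 : z ^ r ≈ 0#
  z^r≈0 = proj₁ z-nilpotent

  -- Modulo x, the relation 1 = i z + j x makes 1 a multiple of every power of z.
  z∤⇒unit : ∀ {x} → ¬ z ∣ x → IsUnit commutativeRing x
  z∤⇒unit {x} z∤x = let w , c , eq = power r in inverse⇒unit w (begin
    w * x                ≈⟨ +-identityʳ (w * x) ⟨
    w * x + 0#           ≈⟨ +-congˡ (trans (*-congˡ z^r≈0) (zeroʳ c)) ⟨
    w * x + c * z ^ r    ≈⟨ eq ⟩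
    1#                   ∎)
    where
    power : ∀ n → ∃[ w ] ∃[ c ] w * x + c * z ^ n ≈ 1#
    power zero    = 0# , 1# , trans (+-cong (zeroˡ x) (*-identityˡ 1#)) (+-identityˡ 1#)
    power (suc n) with power n | z∤⇒1∈⟨z,x⟩ z∤x
    ... | w , c , eq | i , j , iz+jx≈1 = w + c * z ^ n * j , c * i , (begin
      (w + c * z ^ n * j) * x + c * i * (z * z ^ n)
        ≈⟨ solve 7 (λ w c u j x i z → (w :+ c :* u :* j) :* x :+ c :* i :* (z :* u) :=
                                      w :* x :+ c :* u :* (i :* z :+ j :* x)) refl w c (z ^ n) j x i z ⟩
      w * x + c * z ^ n * (i * z + j * x)
        ≈⟨ +-congˡ (trans (*-congˡ iz+jx≈1) (*-identityʳ (c * z ^ n))) ⟩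
      w * x + c * z ^ n
        ≈⟨ eq ⟩
      1# ∎)

  1≤r : 1 ≤ r
  1≤r = positive r z^r≈0
    where
    positive : ∀ n → z ^ n ≈ 0# → 1 ≤ n
    positive zero    1≈0 = ⊥-elim (z∤1 (0# , trans (zeroˡ z) (sym 1≈0)))
    positive (suc n) _   = s≤s z≤n

  module Q = Inverse residue

  -- The truncated expansions d₀ + d₁ z + ... + dₙ₋₁ zⁿ⁻¹, each digit being a chosen representative
  -- of a residue class modulo z.
  digits : ℕ → List Carrier
  digits zero    = [ 0# ]
  digits (suc n) = cartesianProductWith (λ d y → Q.from d + z * y) (allFin q) (digits n)

  length-digits : ∀ n → length (digits n) ≡ q ℕ.^ n
  length-digits zero    = ≡.refl
  length-digits (suc n) = ≡.trans (length-cartesianProductWith _ (allFin q) (digits n))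
    (≡.cong₂ ℕ._*_ (length-tabulate {n = q} id) (length-digits n))

  -- Removing the residue of x modulo z leaves a multiple z k, and the induction expands k.
  digits-complete : ∀ n x → ∃[ y ] y ∈ digits n × ∃[ w ] x ≈ y + z ^ n * w
  digits-complete zero    x = 0# , here ≡.refl , x , sym (trans (+-identityˡ (1# * x)) (*-identityˡ x))
  digits-complete (suc n) x with ∣-difference⇒ (Setoid.sym (quotient commutativeRing z) (Q.strictlyInverseʳ x))
  ... | k , x≈d+zk with digits-complete n k
  ...   | y , y∈ , w , k≈y+z^nw =
    _ , ∈-cartesianProductWith⁺ _ (∈-allFin (Q.to x)) y∈ , w , (begin
      x                                          ≈⟨ x≈d+zk ⟩
      Q.from (Q.to x) + z * k                    ≈⟨ +-congˡ (*-congˡ k≈y+z^nw) ⟩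
      Q.from (Q.to x) + z * (y + z ^ n * w)
        ≈⟨ solve 5 (λ d z y u w → d :+ z :* (y :+ u :* w) := d :+ z :* y :+ z :* u :* w)
             refl (Q.from (Q.to x)) z y (z ^ n) w ⟩
      Q.from (Q.to x) + z * y + z * z ^ n * w    ∎)

  -- For c = z^j with j ≤ r, this equality is congruence modulo z^(r-j).
  scaledSetoid : Carrier → Setoid a ℓ
  scaledSetoid c = record { isEquivalence = On.isEquivalence (c *_) isEquivalence }

  unit-+-z* : ∀ {u} → IsUnit commutativeRing u → ∀ w → IsUnit commutativeRing (u + z * w)
  unit-+-z* {u} u-unit w = z∤⇒unit λ { (k , kz≈) → unit⇒z∤ u-unit (k - w ,
    +-cancelʳ (z * w) _ _ (begin
      (k - w) * z + z * w    ≈⟨ solve 3 (λ d w z → d :* z :+ z :* w := (d :+ w) :* z) refl (k - w) w z ⟩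
      (k - w + w) * z        ≈⟨ *-congʳ (x-y+y≈x k w) ⟩
      k * z                  ≈⟨ kz≈ ⟩
      u + z * w              ∎)) }

  -- Different digits differ by a unit, which stays a unit after a multiple of z is added.
  -- Cancelling it from the difference of the two sides would leave z^j ≈ 0 with j < r, against the
  -- minimality of r.
  leading-digit : ∀ {j} → j ℕ.< r → ∀ {d d′ y y′} →
                  z ^ j * (Q.from d + z * y) ≈ z ^ j * (Q.from d′ + z * y′) → d ≡ d′
  leading-digit {j} j<r {d} {d′} {y} {y′} eq with z∣? (Q.from d - Q.from d′)
  ... | yes z∣d-d′ = ≡.trans (≡.sym (Q.strictlyInverseˡ d))
                       (≡.trans (Q.to-cong z∣d-d′) (Q.strictlyInverseˡ d′))
  ... | no  z∤d-d′ = ⊥-elim (proj₂ z-nilpotent j j<r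
    (unit-cancelʳ (unit-+-z* (z∤⇒unit z∤d-d′) (y - y′)) (trans z^jδ≈0 (sym (zeroˡ _)))))
    where
    δ = Q.from d - Q.from d′
    z^jδ≈0 : z ^ j * (δ + z * (y - y′)) ≈ 0#
    z^jδ≈0 = +-cancelʳ (z ^ j * (Q.from d′ + z * y′)) _ _ (begin
      z ^ j * (δ + z * (y - y′)) + z ^ j * (Q.from d′ + z * y′)
        ≈⟨ solve 6 (λ u δ z η d y → u :* (δ :+ z :* η) :+ u :* (d :+ z :* y) :=
                                    u :* (δ :+ d :+ z :* (η :+ y))) refl
             (z ^ j) δ z (y - y′) (Q.from d′) y′ ⟩
      z ^ j * (δ + Q.from d′ + z * (y - y′ + y′))
        ≈⟨ *-congˡ (+-cong (x-y+y≈x _ _) (*-congˡ (x-y+y≈x y y′))) ⟩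
      z ^ j * (Q.from d + z * y)
        ≈⟨ eq ⟩
      z ^ j * (Q.from d′ + z * y′)
        ≈⟨ +-identityˡ _ ⟨
      0# + z ^ j * (Q.from d′ + z * y′) ∎)

  -- Since z is a zero divisor, removing the leading digit leaves its factor z in the scale.
  digits-unique : ∀ n j → j ℕ.+ n ≡ r → Unique (scaledSetoid (z ^ j)) (digits n)
  digits-unique zero    j j+n≡r = [] ∷ []
  digits-unique (suc n) j j+n≡r = UniqueProperties.cartesianProductWith⁺
    (≡.setoid (Fin q)) (scaledSetoid (z ^ suc j)) (scaledSetoid (z ^ j)) _ injective
    (allFin⁺ q) (digits-unique n (suc j) 1+j+n≡r)
    where
    1+j+n≡r = ≡.trans (≡.sym (ℕ.+-suc j n)) j+n≡r
    injective : ∀ {d d′ y y′} → z ^ j * (Q.from d + z * y) ≈ z ^ j * (Q.from d′ + z * y′) →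
                d ≡ d′ × z ^ suc j * y ≈ z ^ suc j * y′
    injective {d} {d′} {y} {y′} eq
      with leading-digit {j} (≡.subst (suc j ≤_) 1+j+n≡r (ℕ.m≤m+n (suc j) n)) eq
    ... | ≡.refl = ≡.refl , +-cancelˡ (z ^ j * Q.from d) _ _ (begin
      z ^ j * Q.from d + z * z ^ j * y     ≈⟨ expand y ⟩
      z ^ j * (Q.from d + z * y)           ≈⟨ eq ⟩
      z ^ j * (Q.from d + z * y′)          ≈⟨ expand y′ ⟨
      z ^ j * Q.from d + z * z ^ j * y′    ∎)
      where
      expand : ∀ y → z ^ j * Q.from d + z * z ^ j * y ≈ z ^ j * (Q.from d + z * y)
      expand y = solve 4 (λ u d z y → u :* d :+ z :* u :* y := u :* (d :+ z :* y)) refl (z ^ j) (Q.from d) z y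

  -- Expansions of length r reach every element because z^r ≈ 0, and no two of the q^r expansions
  -- coincide.
  order≡q^r : order ≡ q ℕ.^ r
  order≡q^r = ℕ.≤-antisym
    (≡.subst₂ _≤_ length-elements (length-digits r)
      (length-≤ ≈-setoid (λ x y → x ≟ y) elements-unique (digits r)
        (λ x → let y , y∈ , w , x≈ = digits-complete r x in
          y , y∈ , trans x≈ (trans (+-congˡ (trans (*-congʳ z^r≈0) (zeroˡ w))) (+-identityʳ y)))
        (λ x≈y x′≈y → trans x≈y (sym x′≈y))))
    (≡.subst₂ _≤_ (length-digits r) length-elements
      -- At j = 0 the scale z^0 is 1, so distinctness of the expansions is stated after
      -- multiplication by `1#`.
      (length-≤ (scaledSetoid 1#) (λ x y → x ≟ y) (digits-unique r 0 ≡.refl) elements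
        (λ x → canonical x , canonical∈ x , sym (canonical≈ x))
        (λ x≈y x′≈y → *-congˡ (trans x≈y (sym x′≈y)))))

length-cartesianProduct : ∀ {a b} {A : Set a} {B : Set b} (xs : List A) (ys : List B) →
                          length (cartesianProduct xs ys) ≡ length xs ℕ.* length ys
length-cartesianProduct = length-cartesianProductWith _,_

-- Incidences between lines and a grid of points.

module Incidence {a ℓ : Level} (V : FiniteValuationRing a ℓ)
  {z : FiniteValuationRing.Carrier V} (z-uniformizer : FiniteValuationRing.IsUniformizer V z)
  {r q : ℕ} (z-nilpotent : IsNilpotencyDegree (FiniteValuationRing.commutativeRing V) z r)
  (residue : quotient (FiniteValuationRing.commutativeRing V) z HasCardinality q) where

  open FiniteValuationRing V hiding (∣_∣; _≟_)
  open ValuationRing V z-uniformizer z-nilpotent residue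
  open import Relation.Binary.Reasoning.Setoid ≈-setoid

  Line Point : Set a
  Line  = Carrier × Carrier
  Point = Carrier × Carrier

  -- For a unit s, division by s gives m + k s = t / s, a genuine line in the coordinates (s , t /
  -- s). The undivided form makes sense for every s.
  _through_ : Line → Point → Set ℓ
  (m , k) through (s , t) = m * s + k * (s * s) ≈ t

  _through?_ : ∀ l p → Dec (l through p)
  (m , k) through? (s , t) = (m * s + k * (s * s)) ≟ t

  lines : List Line
  lines = cartesianProduct elements elements

  line-setoid : Setoid a ℓ
  line-setoid = ≈-setoid ×ₛ ≈-setoid

  lines-unique : Unique line-setoid lines
  lines-unique = UniqueProperties.cartesianProduct⁺ ≈-setoid ≈-setoid elements-unique elements-unique

  slope-determined : ∀ {s m m′ k k′} → IsUnit commutativeRing s →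
                     m * s + k * (s * s) ≈ m′ * s + k′ * (s * s) → m + k * s ≈ m′ + k′ * s
  slope-determined {s} {m} {m′} {k} {k′} s-unit eq =
    unit-cancelʳ s-unit (trans (factor m k) (trans eq (sym (factor m′ k′))))
    where
    factor : ∀ m k → (m + k * s) * s ≈ m * s + k * (s * s)
    factor m k = solve 3 (λ m k s → (m :+ k :* s) :* s := m :* s :+ k :* (s :* s)) refl m k s

  -- Division by s and by s′ leaves two linear equations in (m , k). Their difference fixes k,
  -- because s - s′ is a unit, and then either equation fixes m.
  line-determined : ∀ {s s′ t t′} → IsUnit commutativeRing s → IsUnit commutativeRing s′ →
    IsUnit commutativeRing (s - s′) → ∀ {l l′} →
    l through (s , t) × l through (s′ , t′) → l′ through (s , t) × l′ through (s′ , t′) →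
    Setoid._≈_ line-setoid l l′
  line-determined {s} {s′} s-unit s′-unit d-unit {m , k} {m₁ , k₁} (p , p′) (p₁ , p₁′) = m≈m₁ , k≈k₁
    where
    d = s - s′
    at-s : m + k * s ≈ m₁ + k₁ * s
    at-s = slope-determined s-unit (trans p (sym p₁))
    at-s′ : m + k * s′ ≈ m₁ + k₁ * s′
    at-s′ = slope-determined s′-unit (trans p′ (sym p₁′))
    shift : ∀ m k → m + k * s′ + k * d ≈ m + k * s
    shift m k = trans
      (solve 4 (λ m k s d → m :+ k :* s :+ k :* d := m :+ k :* (d :+ s)) refl m k s′ d)
      (+-congˡ (*-congˡ (x-y+y≈x s s′)))
    k≈k₁ : k ≈ k₁
    k≈k₁ = unit-cancelʳ d-unit (+-cancelˡ (m + k * s′) _ _ (begin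
      m + k * s′ + k * d       ≈⟨ shift m k ⟩
      m + k * s                ≈⟨ at-s ⟩
      m₁ + k₁ * s              ≈⟨ shift m₁ k₁ ⟨
      m₁ + k₁ * s′ + k₁ * d    ≈⟨ +-congʳ at-s′ ⟨
      m + k * s′ + k₁ * d      ∎))
    m≈m₁ : m ≈ m₁
    m≈m₁ = +-cancelʳ (k * s) _ _ (trans at-s (+-congˡ (*-congʳ (sym k≈k₁))))

  -- Each k gives a line through (s , t), namely the one with m = (t - k s²) / s.
  order≤lines-through : ∀ {s} → IsUnit commutativeRing s → ∀ t →
                        order ≤ ∑[ l ← lines ] ⟦ l through? (s , t) ⟧
  order≤lines-through {s} (i , is≈1 , si≈1) t = ℕ.≤-trans
    (ℕ.≤-reflexive (≡.trans (≡.sym length-elements) (≡.sym (∑-1 elements))))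
    (∑-⟦⟧-≤ ≈-setoid (λ _ → yes tt) (λ l → l through? (s , t))
      (λ { k l@(_ , k′) → (k ≟ k′) ×-dec (l through? (s , t)) })
      elements-unique lines
      (λ {k} _ _ → (canonical (m k) , canonical k) ,
        ∈-cartesianProduct⁺ (canonical∈ (m k)) (canonical∈ k) ,
        sym (canonical≈ k) , passes k)
      (λ _ _ (k≈k′ , _) (k₁≈k′ , _) → trans k≈k′ (sym k₁≈k′))
      (λ _ → proj₂))
    where
    m : Carrier → Carrier
    m k = (t - k * (s * s)) * i
    passes : ∀ k → canonical (m k) * s + canonical k * (s * s) ≈ t
    passes k = begin
      canonical (m k) * s + canonical k * (s * s)
        ≈⟨ +-cong (*-congʳ (canonical≈ (m k))) (*-congʳ (canonical≈ k)) ⟩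
      (t - k * (s * s)) * i * s + k * (s * s)
        ≈⟨ +-congʳ (trans (*-assoc _ i s) (trans (*-congˡ is≈1) (*-identityʳ _))) ⟩
      t - k * (s * s) + k * (s * s)
        ≈⟨ x-y+y≈x t (k * (s * s)) ⟩
      t ∎

  module _ {S T : List Carrier} (S-units : ∀ {s} → s ∈ S → IsUnit commutativeRing s)
           (S! : Unique ≈-setoid S) (T! : Unique ≈-setoid T) where

    points : List Point
    points = cartesianProduct S T

    points-unique : Unique (≈-setoid ×ₛ ≈-setoid) points
    points-unique = UniqueProperties.cartesianProduct⁺ ≈-setoid ≈-setoid S! T!

    -- Two points whose s-coordinates differ by a unit lie on at most one common line. The pairs
    -- (p′ , line through p and p′) for the other p′ are determined by k and (s - s′) / z mod zʳ⁻¹.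
    common-lines : ∀ {p} → p ∈ points →
      ∑[ p′ ← points ] ∑[ l ← lines ] (⟦ l through? p ⟧ ℕ.* ⟦ l through? p′ ⟧) ≤
      length points ℕ.+ order ℕ.* q ℕ.^ (r ℕ.∸ 1)
    common-lines {s , t} p∈ = ℕ.≤-trans (∑-mono points separate)
      (ℕ.≤-trans (ℕ.≤-reflexive (≡.trans (∑-+ points)
          (≡.cong₂ ℕ._+_ (∑-1 points) (≡.sym (∑-cartesianProduct points lines _)))))
        (ℕ.+-monoʳ-≤ (length points) close-pairs))
      where
      s-unit : IsUnit commutativeRing s
      s-unit = S-units (proj₁ (∈-cartesianProduct⁻ S T p∈))

      both? : ∀ p′ l → Dec (l through (s , t) × l through p′)
      both? p′ l = (l through? (s , t)) ×-dec (l through? p′)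

      Close : Point × Line → Set (a ⊔ ℓ)
      Close ((s′ , t′) , l) = z ∣ (s - s′) × l through (s , t) × l through (s′ , t′)

      close? : ∀ pl → Dec (Close pl)
      close? (p′ , l) = z∣? (s - proj₁ p′) ×-dec both? p′ l

      -- The summand 1 pays for the single line possible when s - s′ is a unit. When z divides s -
      -- s′, every common line is counted as close.
      separate : ∀ {p′} → p′ ∈ points →
        ∑[ l ← lines ] (⟦ l through? (s , t) ⟧ ℕ.* ⟦ l through? p′ ⟧) ≤
        1 ℕ.+ ∑[ l ← lines ] ⟦ close? (p′ , l) ⟧
      separate {p′@(s′ , t′)} p′∈ = ℕ.≤-trans
        (ℕ.≤-reflexive (∑-cong lines λ l → ≡.sym (⟦⟧-× (l through? (s , t)) (l through? p′))))
        (split (z∣? (s - s′)))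
        where
        split : Dec (z ∣ (s - s′)) →
          ∑[ l ← lines ] ⟦ both? p′ l ⟧ ≤ 1 ℕ.+ ∑[ l ← lines ] ⟦ close? (p′ , l) ⟧
        split (yes z∣d) = ℕ.m≤n⇒m≤1+n
          (∑-mono lines λ {l} _ → ⟦⟧-mono (both? p′ l) (close? (p′ , l)) (z∣d ,_))
        split (no z∤d) = ℕ.≤-trans
          (∑-⟦⟧-atMostOne line-setoid (both? p′) (yes tt) lines-unique
            (line-determined s-unit (S-units (proj₁ (∈-cartesianProduct⁻ S T p′∈)))
              (z∤⇒unit z∤d)) _)
          (ℕ.m≤m+n 1 _)

      ds = digits (r ℕ.∸ 1)

      -- Since z zʳ⁻¹ ≈ 0, the product z x depends only on the first r - 1 digits of x. This is what
      -- makes the count of close pairs smaller than `order` squared by a factor q.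
      z*digit : ∀ x → ∃[ y ] y ∈ ds × z * x ≈ z * y
      z*digit x with digits-complete (r ℕ.∸ 1) x
      ... | y , y∈ , w , x≈ = y , y∈ , (begin
        z * x                              ≈⟨ *-congˡ x≈ ⟩
        z * (y + z ^ (r ℕ.∸ 1) * w)
          ≈⟨ solve 4 (λ z y u w → z :* (y :+ u :* w) := z :* y :+ z :* u :* w) refl z y (z ^ (r ℕ.∸ 1)) w ⟩
        z * y + z ^ suc (r ℕ.∸ 1) * w
          ≡⟨ ≡.cong (λ n → z * y + z ^ n * w) (ℕ.m+[n∸m]≡n 1≤r) ⟩
        z * y + z ^ r * w
          ≈⟨ +-congˡ (trans (*-congʳ z^r≈0) (zeroˡ w)) ⟩
        z * y + 0#                         ≈⟨ +-identityʳ (z * y) ⟩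
        z * y                              ∎)

      Encodes : Point × Line → Carrier × Carrier → Set ℓ
      Encodes ((s′ , _) , (_ , k)) (k′ , y) = k ≈ k′ × s ≈ s′ + z * y

      encodes? : ∀ pl ky → Dec (Encodes pl ky)
      encodes? ((s′ , _) , (_ , k)) (k′ , y) = (k ≟ k′) ×-dec (s ≟ (s′ + z * y))

      -- The code gives k and s′ = s - z y. Incidence with (s , t) then determines m, as s is a
      -- unit, and incidence with (s′ , t′) determines t′.
      encode-injective : ∀ {pl pl₁ ky} → Close pl → Close pl₁ → Encodes pl ky → Encodes pl₁ ky →
                         Setoid._≈_ ((≈-setoid ×ₛ ≈-setoid) ×ₛ line-setoid) pl pl₁
      encode-injective {(s′ , t′) , (m , k)} {(s₁ , t₁) , (m₁ , k₁)} {k′ , y}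
        (_ , p , p′) (_ , p₁ , p₁′) (k≈k′ , s≈) (k₁≈k′ , s≈₁) = (s′≈s₁ , t′≈t₁) , (m≈m₁ , k≈k₁)
        where
        k≈k₁  = trans k≈k′ (sym k₁≈k′)
        s′≈s₁ = +-cancelʳ (z * y) _ _ (trans (sym s≈) s≈₁)
        m≈m₁  = +-cancelʳ (k * s) _ _ (trans (slope-determined s-unit (trans p (sym p₁)))
                  (+-congˡ (*-congʳ (sym k≈k₁))))
        t′≈t₁ = trans (sym p′) (trans
                  (+-cong (*-cong m≈m₁ s′≈s₁) (*-cong k≈k₁ (*-cong s′≈s₁ s′≈s₁))) p₁′)

      close-pairs : ∑ (cartesianProduct points lines) (λ pl → ⟦ close? pl ⟧) ≤ order ℕ.* q ℕ.^ (r ℕ.∸ 1)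
      close-pairs = ℕ.≤-trans
        (∑-⟦⟧-≤ ((≈-setoid ×ₛ ≈-setoid) ×ₛ line-setoid) close? (λ _ → yes tt) encodes?
          (UniqueProperties.cartesianProduct⁺ (≈-setoid ×ₛ ≈-setoid) line-setoid points-unique lines-unique)
          (cartesianProduct elements ds)
          (λ { {(s′ , _) , (_ , k)} _ (z∣d , _) →
            let x , s≈ = ∣-difference⇒ z∣d
                y , y∈ , zx≈zy = z*digit x
            in (canonical k , y) , ∈-cartesianProduct⁺ (canonical∈ k) y∈ ,
               sym (canonical≈ k) , trans s≈ (+-congˡ zx≈zy) })
          encode-injective _)
        (ℕ.≤-reflexive (≡.trans (∑-1 (cartesianProduct elements ds))
          (≡.trans (length-cartesianProduct elements ds)
            (≡.cong₂ ℕ._*_ length-elements (length-digits (r ℕ.∸ 1))))))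

  -- Lines presented by pairs (x , c): multiplicity, richness and the resulting bound.

  module _ (g : Func Unit-setoid Unit-setoid) where

    g′ : Unit → Carrier
    g′ x = val (Func.to g x)

    -- Substituting b = s / c into t = f (x , b) = x g(x) b + x b² gives t = m s + k s² with
    -- m = x g(x) / c and k = x / c².
    Presents : Unit × Unit → Line → Set ℓ
    Presents (x , c) (m , k) = val x * g′ x ≈ m * val c × val x ≈ k * (val c * val c)

    presents? : ∀ xc l → Dec (Presents xc l)
    presents? (x , c) (m , k) = ((val x * g′ x) ≟ (m * val c)) ×-dec (val x ≟ (k * (val c * val c)))

    presented : ∀ xc → ∃[ l ] l ∈ lines × Presents xc l
    presented (x , (c , i , ic≈1 , _)) =
      (canonical m , canonical k) , ∈-cartesianProduct⁺ (canonical∈ m) (canonical∈ k) ,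
      sym (trans (*-congʳ (canonical≈ m))
        (trans (*-assoc _ i c) (trans (*-congˡ ic≈1) (*-identityʳ _)))) ,
      sym (begin
        canonical k * (c * c)          ≈⟨ *-congʳ (canonical≈ k) ⟩
        val x * (i * i) * (c * c)
          ≈⟨ solve 3 (λ x i c → x :* (i :* i) :* (c :* c) := x :* ((i :* c) :* (i :* c))) refl (val x) i c ⟩
        val x * ((i * c) * (i * c))    ≈⟨ *-congˡ (trans (*-cong ic≈1 ic≈1) (*-identityˡ 1#)) ⟩
        val x * 1#                     ≈⟨ *-identityʳ (val x) ⟩
        val x                          ∎)
      where
      m = val x * g′ x * i
      k = val x * (i * i)

    units-complete : ∀ u → ∃[ v ] v ∈ units × val u ≈ val v
    units-complete (x , x-unit) = find (AnyProperties.mapMaybe⁺ _ elements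
      (AnyProperties.map⁺ (lose (canonical∈ x) (decided (unit? (canonical x))))))
      where
      decided : (d : Dec (IsUnit commutativeRing (canonical x))) →
                MaybeAny.Any (λ v → x ≈ val v) (Maybe.map (canonical x ,_) (dec⇒maybe d))
      decided (yes _)    = MaybeAny.just (sym (canonical≈ x))
      decided (no ¬unit) = ⊥-elim (¬unit (unit-resp (sym (canonical≈ x)) x-unit))

    -- The maximum `μ` runs over the entries of `elements`, so the fibre is taken over the
    -- representative of t listed there.
    fibre≤μ : ∀ (φ : Func Unit-setoid ≈-setoid) t →
              ∑[ u ← units ] ⟦ Func.to φ u ≟ canonical t ⟧ ≤ μ φ
    fibre≤μ φ t = ℕ.≤-trans (ℕ.≤-reflexive (∑-⟦⟧-filter (λ u → Func.to φ u ≟ canonical t) units))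
      (All.lookup (xs≤max 0 _)
        (∈-map⁺ (λ t → length (filter (λ u → Func.to φ u ≟ t) units)) (canonical∈ t)))

    val-unit : ∀ u → IsUnit commutativeRing (val u)
    val-unit = proj₂

    -- In m² / k the powers of c cancel and (x g(x))² / x = ψ(x) remains; the product form avoids
    -- inverting k.
    Presents⇒ψ : ∀ {x c m k} → Presents (x , c) (m , k) → k * Func.to (ψ g) x ≈ m * m
    Presents⇒ψ {x} {c} {m} {k} (xg≈mc , x≈kcc) = unit-cancelʳ (unit-* (val-unit c) (val-unit c)) (begin
      k * (h * h * y) * (w * w)
        ≈⟨ solve 4 (λ k h y w → k :* (h :* h :* y) :* (w :* w) := h :* h :* y :* (k :* (w :* w))) refl k h y w ⟩
      h * h * y * (k * (w * w))    ≈⟨ *-congˡ x≈kcc ⟨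
      h * h * y * y                ≈⟨ solve 2 (λ h y → h :* h :* y :* y := (y :* h) :* (y :* h)) refl h y ⟩
      (y * h) * (y * h)            ≈⟨ *-cong xg≈mc xg≈mc ⟩
      (m * w) * (m * w)            ≈⟨ solve 2 (λ m w → (m :* w) :* (m :* w) := m :* m :* (w :* w)) refl m w ⟩
      m * m * (w * w)              ∎)
      where
      y = val x
      h = g′ x
      w = val c

    -- This is c = x g(x) / m without division by m: both x g(x) c and x g(x) c₁ equal m c c₁, and x
    -- g(x) is a unit because g takes unit values.
    Presents-injective : ∀ {x x₁ c c₁ l} → Presents (x , c) l → Presents (x₁ , c₁) l →
                         val x ≈ val x₁ → val c ≈ val c₁
    Presents-injective {x} {x₁} {c} {c₁} {m , k} (xg≈mc , _) (x₁g₁≈mc₁ , _) x≈x₁ =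
      unit-cancelˡ (unit-* (val-unit x) (val-unit (Func.to g x))) (begin
        val x * g′ x * val c        ≈⟨ *-congʳ (*-cong x≈x₁ (Func.cong g {x} {x₁} x≈x₁)) ⟩
        val x₁ * g′ x₁ * val c      ≈⟨ *-congʳ x₁g₁≈mc₁ ⟩
        m * val c₁ * val c          ≈⟨ solve 3 (λ m c d → m :* c :* d := m :* d :* c) refl m (val c₁) (val c) ⟩
        m * val c * val c₁          ≈⟨ *-congʳ xg≈mc ⟨
        val x * g′ x * val c₁       ∎)

    -- The first coordinates of the pairs presenting a line lie in the fibre of ψ over m² / k, and
    -- each of them determines its pair. If k is not a unit there are no such pairs, since x = k c²
    -- would make k a unit.
    multiplicity≤μ : ∀ {A C} → Unique Unit-setoid A → Unique Unit-setoid C → ∀ l →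
                     ∑[ xc ← cartesianProduct A C ] ⟦ presents? xc l ⟧ ≤ μ (ψ g)
    multiplicity≤μ {A} {C} A! C! l@(m , k) with unit? k
    ... | no ¬k-unit = ℕ.≤-trans (ℕ.≤-reflexive
      (∑-⟦⟧-none (λ xc → presents? xc l) (cartesianProduct A C)
        (λ { {x , c} _ (_ , x≈kcc) → ¬k-unit (unit-factorˡ (unit-resp x≈kcc (val-unit x))) }))) z≤n
    ... | yes (i , ik≈1 , _) = ℕ.≤-trans
      (∑-⟦⟧-≤ (Unit-setoid ×ₛ Unit-setoid) (λ xc → presents? xc l)
        (λ u → Func.to (ψ g) u ≟ canonical (i * (m * m))) (λ xc u → val (proj₁ xc) ≟ val u)
        (UniqueProperties.cartesianProduct⁺ Unit-setoid Unit-setoid A! C!) units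
        (λ {xc} _ _ → units-complete (proj₁ xc))
        (λ { {x , c} {x₁ , c₁} pr pr₁ x≈u x₁≈u →
          let x≈x₁ = trans x≈u (sym x₁≈u) in
          x≈x₁ , Presents-injective {x} {x₁} {c} {c₁} {l} pr pr₁ x≈x₁ })
        (λ { {x , c} {u} pr x≈u → begin
          Func.to (ψ g) u              ≈⟨ Func.cong (ψ g) {x} {u} x≈u ⟨
          Func.to (ψ g) x              ≈⟨ *-identityˡ _ ⟨
          1# * Func.to (ψ g) x         ≈⟨ *-congʳ ik≈1 ⟨
          i * k * Func.to (ψ g) x      ≈⟨ *-assoc i k _ ⟩
          i * (k * Func.to (ψ g) x)    ≈⟨ *-congˡ (Presents⇒ψ {x} {c} pr) ⟩
          i * (m * m)                  ≈⟨ canonical≈ _ ⟨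
          canonical (i * (m * m))      ∎ }))
      (fibre≤μ (ψ g) (i * (m * m)))

    module _ (A B C : List Unit) where

      open DecSetoid Unit-decSetoid using () renaming (_≟_ to _≟ᵤ_)

      A′ B′ C′ : List Unit
      A′ = deduplicate _≟ᵤ_ A
      B′ = deduplicate _≟ᵤ_ B
      C′ = deduplicate _≟ᵤ_ C

      S T : List Carrier
      S = deduplicate _≟_ (B · C)
      T = deduplicate _≟_ (f[_,_] g A B)

      deduplicate-unique : ∀ xs → Unique Unit-setoid (deduplicate _≟ᵤ_ xs)
      deduplicate-unique = UniqueDecProperties.deduplicate-! Unit-decSetoid

      deduplicate-⊆ : ∀ xs {x} → x ∈ deduplicate _≟ᵤ_ xs → x ∈ xs
      deduplicate-⊆ xs = AnyProperties.deduplicate⁻ _≟ᵤ_ {xs = xs}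

      S-units : ∀ {s} → s ∈ S → IsUnit commutativeRing s
      S-units s∈S with ∈-cartesianProductWith⁻ _ B C (AnyProperties.deduplicate⁻ _≟_ {xs = B · C} s∈S)
      ... | b , c , _ , _ , ≡.refl = unit-* (val-unit b) (val-unit c)

      S! : Unique ≈-setoid S
      S! = UniqueDecProperties.deduplicate-! ≈-decSetoid (B · C)

      T! : Unique ≈-setoid T
      T! = UniqueDecProperties.deduplicate-! ≈-decSetoid (f[_,_] g A B)

      represented : ∀ {xs x} → x ∈ xs → ∃[ y ] y ∈ deduplicate _≟_ xs × x ≈ y
      represented x∈xs = find (AnyProperties.deduplicate⁺ _≟_ (λ y′≈y x≈y → trans x≈y (sym y′≈y))
        (lose {P = _ ≈_} x∈xs refl))

      pts : List Point
      pts = points S-units S! T!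

      w : Line → ℕ
      w l = ∑[ xc ← cartesianProduct A′ C′ ] ⟦ presents? xc l ⟧

      -- Positive weight yields a pair (x , c) presenting the line. Every b then gives the point (b
      -- c , f(x , b)) on it, and different b give different b c because c is a unit.
      rich : ∀ l → 1 ≤ w l → length B′ ≤ ∑[ p ← pts ] ⟦ l through? p ⟧
      rich l@(m , k) 1≤w with Any.any? (λ xc → presents? xc l) (cartesianProduct A′ C′)
      ... | no none = ⊥-elim (ℕ.n≮0 (≡.subst (1 ≤_)
        (∑-⟦⟧-none (λ xc → presents? xc l) (cartesianProduct A′ C′) (λ xc∈ pr → none (lose xc∈ pr))) 1≤w))
      ... | yes some with find some
      ...   | (x , c) , xc∈ , xg≈mc , x≈kcc = ℕ.≤-trans (ℕ.≤-reflexive (≡.sym (∑-1 B′)))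
        (∑-⟦⟧-≤ Unit-setoid (λ _ → yes tt) (λ p → l through? p)
          (λ b (s , t) → ((val b * val c) ≟ s) ×-dec (f g x b ≟ t))
          (deduplicate-unique B) pts
          (λ b∈B′ _ →
            let b∈B = deduplicate-⊆ B b∈B′
                s , s∈ , bc≈s = represented (∈-cartesianProductWith⁺ (λ b c → val b * val c) b∈B c∈C)
                t , t∈ , f≈t = represented (∈-cartesianProductWith⁺ (f g) x∈A b∈B)
            in (s , t) , ∈-cartesianProduct⁺ s∈ t∈ , bc≈s , f≈t)
          (λ _ _ (bc≈s , _) (b₁c≈s , _) → unit-cancelʳ (val-unit c) (trans bc≈s (sym b₁c≈s)))
          (λ { {b} {s , t} _ (bc≈s , f≈t) → begin
            m * s + k * (s * s)
              ≈⟨ +-cong (*-congˡ bc≈s) (*-congˡ (*-cong bc≈s bc≈s)) ⟨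
            m * (val b * val c) + k * (val b * val c * (val b * val c))
              ≈⟨ solve 4 (λ m k b c → m :* (b :* c) :+ k :* (b :* c :* (b :* c)) :=
                                      m :* c :* b :+ k :* (c :* c) :* (b :* b)) refl m k (val b) (val c) ⟩
            m * val c * val b + k * (val c * val c) * (val b * val b)
              ≈⟨ +-cong (*-congʳ xg≈mc) (*-congʳ x≈kcc) ⟨
            val x * g′ x * val b + val x * (val b * val b)
              ≈⟨ solve 3 (λ x g b → x :* g :* b :+ x :* (b :* b) := x :* b :* (g :+ b)) refl (val x) (g′ x) (val b) ⟩
            f g x b
              ≈⟨ f≈t ⟩
            t ∎ }))
        where
        x∈A = deduplicate-⊆ A (proj₁ (∈-cartesianProduct⁻ A′ C′ xc∈))
        c∈C = deduplicate-⊆ C (proj₂ (∈-cartesianProduct⁻ A′ C′ xc∈))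

      ∣A∣∣C∣≤∑w : length A′ ℕ.* length C′ ≤ ∑ lines w
      ∣A∣∣C∣≤∑w = ℕ.≤-trans
        (ℕ.≤-reflexive (≡.trans (≡.sym (length-cartesianProduct A′ C′)) (≡.sym (ℕ.*-identityʳ _))))
        (ℕ.≤-trans
          (const-≤-∑ (cartesianProduct A′ C′) λ {xc} _ →
            let l , l∈ , pr = presented xc in
            ℕ.≤-trans (ℕ.≤-reflexive (≡.sym (⟦⟧-true (presents? xc l) pr)))
              (f≤∑ (λ l → ⟦ presents? xc l ⟧) l∈))
          (ℕ.≤-reflexive (∑-swap (cartesianProduct A′ C′) lines (λ xc l → ⟦ presents? xc l ⟧))))

      private
        P = length T ℕ.* length S

        length-pts : length pts ≡ P
        length-pts = ≡.trans (length-cartesianProduct S T) (ℕ.*-comm (length S) (length T))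

      -- The alternatives match the two terms of the minimum. If q^r |B| ≥ 2P, the mean number of
      -- incidences P / q^r is at most |B| / 2, as `rich-lines` requires.
      image-product-bound : ∀ {K} → 1 ≤ K → μ (ψ g) ≤ K →
        q ℕ.^ r ℕ.* length B′ ≤ 4 ℕ.* K ℕ.* P ⊎
        length A′ ℕ.* length B′ ℕ.^ 2 ℕ.* length C′ ≤ 4 ℕ.* K ℕ.* P ℕ.* q ℕ.^ (2 ℕ.* r ℕ.∸ 1)
      image-product-bound {K} 1≤K μ≤K with ℕ.≤-total (q ℕ.^ r ℕ.* length B′) (2 ℕ.* P)
      -- Since 1 ≤ K, the factor 2 is at most 4K, so both alternatives carry the same constant.
      ... | inj₁ small = inj₁ (ℕ.≤-trans small (ℕ.*-monoˡ-≤ P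
        (ℕ.*-mono-≤ {2} {4} (s≤s (s≤s z≤n)) 1≤K)))
      ... | inj₂ large = inj₂ (≡.subst₂ _≤_
        (regroup (length A′) (length B′) (length C′))
        (≡.cong₂ (λ p d → 4 ℕ.* K ℕ.* p ℕ.* d) length-pts q-powers)
        (ℕ.≤-trans (ℕ.*-monoˡ-≤ (length B′ ℕ.* length B′) ∣A∣∣C∣≤∑w)
          (rich-lines pts lines (λ p l → ⟦ l through? p ⟧) {N = order} {D = order ℕ.* q ℕ.^ (r ℕ.∸ 1)}
            {K = K} {{nonZeroIndex (F.to 0#)}} w
            (≡.trans (length-cartesianProduct elements elements) (≡.cong₂ ℕ._*_ length-elements length-elements))
            (λ { {s , t} p∈ → order≤lines-through (S-units (proj₁ (∈-cartesianProduct⁻ S T p∈))) t })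
            (common-lines S-units S! T!)
            (λ l → ℕ.≤-trans (multiplicity≤μ (deduplicate-unique A) (deduplicate-unique C) l) μ≤K)
            rich
            (≡.subst₂ _≤_ (≡.cong (2 ℕ.*_) (≡.sym length-pts))
              (≡.cong (ℕ._* length B′) (≡.sym order≡q^r)) large))))
        where
        regroup : ∀ a b c → a ℕ.* c ℕ.* (b ℕ.* b) ≡ a ℕ.* (b ℕ.* (b ℕ.* 1)) ℕ.* c
        regroup = solve-∀
        -- The exponents add up as r + (r - 1) = 2r - 1; with truncated subtraction this relies on 1
        -- ≤ r.
        q-powers : order ℕ.* q ℕ.^ (r ℕ.∸ 1) ≡ q ℕ.^ (2 ℕ.* r ℕ.∸ 1)
        q-powers = ≡.trans (≡.cong (ℕ._* q ℕ.^ (r ℕ.∸ 1)) order≡q^r)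
          (≡.trans (≡.sym (ℕ.^-distribˡ-+-* q r (r ℕ.∸ 1)))
            (≡.cong (q ℕ.^_) (≡.trans (≡.sym (ℕ.+-∸-assoc r 1≤r))
              (≡.cong (λ n → r ℕ.+ n ℕ.∸ 1) (≡.sym (ℕ.+-identityʳ r))))))

-- From natural-number inequalities to the rational statement.

open import Data.Integer.Base using (+_)
open import Data.Nat.Base using (_*_; _∸_; _^_)
open import Data.Nat.Properties using (m^n≢0)
open import Data.Rational.Base using (0ℚ; _/_; _⊓_; toℚᵘ) renaming (_*_ to _*ℚ_; _<_ to _<ℚ_; _≤_ to _≤ℚ_)

-- Rationals formed by `_/_` are reduced to lowest terms, so the comparison is moved to unnormalised
-- fractions, where it is cross-multiplication.
1/u*n/d≤p : ∀ u n d p .{{_ : ℕ.NonZero u}} .{{_ : ℕ.NonZero d}} → n ≤ u * p * d →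
            (+ 1 / u) *ℚ (+ n / d) ≤ℚ (+ p / 1)
1/u*n/d≤p u@(suc u′) n d@(suc d′) p n≤upd = ℚ.toℚᵘ-cancel-≤ (begin
  toℚᵘ ((+ 1 / u) *ℚ (+ n / d))        ≃⟨ ℚ.toℚᵘ-homo-* (+ 1 / u) (+ n / d) ⟩
  toℚᵘ (+ 1 / u) ℚᵘ.* toℚᵘ (+ n / d)
    ≃⟨ ℚᵘ.*-cong (ℚ.toℚᵘ-fromℚᵘ (mkℚᵘ (+ 1) u′)) (ℚ.toℚᵘ-fromℚᵘ (mkℚᵘ (+ n) d′)) ⟩
  mkℚᵘ (+ 1) u′ ℚᵘ.* mkℚᵘ (+ n) d′        ≤⟨ *≤* cross ⟩
  mkℚᵘ (+ p) 0                            ≃⟨ ℚ.toℚᵘ-fromℚᵘ (mkℚᵘ (+ p) 0) ⟨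
  toℚᵘ (+ p / 1)                       ∎)
  where
  open ℚᵘ.≤-Reasoning
  rotate : ∀ u p d → u * p * d ≡ p * (u * d)
  rotate = solve-∀
  cross : (+ 1 ℤ.* + n) ℤ.* + 1 ℤ.≤ + p ℤ.* + (u * d)
  cross = ≡.subst₂ ℤ._≤_
    (≡.sym (≡.trans (ℤ.*-identityʳ (+ 1 ℤ.* + n)) (ℤ.*-identityˡ (+ n))))
    (≡.trans (≡.cong +_ (rotate u p d)) (ℤ.pos-* p (u * d)))
    (ℤ.+≤+ n≤upd)

-- The minimum is at most each of its terms, so a bound on one of them suffices.
1/u*[m⊓n/d]≤p : ∀ u m n d p .{{_ : ℕ.NonZero u}} .{{_ : ℕ.NonZero d}} →
                m ≤ u * p ⊎ n ≤ u * p * d → (+ 1 / u) *ℚ ((+ m / 1) ⊓ (+ n / d)) ≤ℚ (+ p / 1)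
1/u*[m⊓n/d]≤p u m n d p (inj₁ m≤up)  = ℚ.≤-trans
  (ℚ.*-monoˡ-≤-nonNeg (+ 1 / u) {{ℚ.normalize-nonNeg 1 u}} (ℚ.p⊓q≤p (+ m / 1) (+ n / d)))
  (1/u*n/d≤p u m 1 p (≡.subst (m ≤_) (≡.sym (ℕ.*-identityʳ (u * p))) m≤up))
1/u*[m⊓n/d]≤p u m n d p (inj₂ n≤upd) = ℚ.≤-trans
  (ℚ.*-monoˡ-≤-nonNeg (+ 1 / u) {{ℚ.normalize-nonNeg 1 u}} (ℚ.p⊓q≤q (+ m / 1) (+ n / d)))
  (1/u*n/d≤p u n d p n≤upd)

theorem1p15 : ∀ {a ℓ} (r K : ℕ) → 1 ≤ K →
    ∃[ c ] (0ℚ <ℚ c) ×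
    (∀ (R : FiniteValuationRing a ℓ) →
    let open FiniteValuationRing R in
    ∀ (z : Carrier) (q : ℕ) → IsUniformizer z →
    (residue : quotient commutativeRing z HasCardinality q) →
    IsNilpotencyDegree commutativeRing z r →
    let q^[2r-1]≢0 = m^n≢0 q (2 * r ∸ 1) {{residue-nonZero commutativeRing residue}} in
    ∀ (g : Func Unit-setoid Unit-setoid) → μ (ψ g) ≤ K →
    ∀ (A B C : List Unit) →
    c *ℚ ((+ (q ^ r * ∣ B ∣ₓ) / 1)
    ⊓ (_/_ (+ (∣ A ∣ₓ * ∣ B ∣ₓ ^ 2 * ∣ C ∣ₓ)) (q ^ (2 * r ∸ 1)) {{q^[2r-1]≢0}}))
    ≤ℚ (+ (∣ f[_,_] g A B ∣ * ∣ B · C ∣) / 1))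
-- The constant is c = 1 / (4K); matching K as a successor shows that 4K is nonzero.
theorem1p15 r K@(suc _) 1≤K = + 1 / (4 * K) , ℚ.positive⁻¹ (+ 1 / (4 * K)) {{ℚ.normalize-pos 1 (4 * K)}} ,
  λ R z q z-uniformizer residue z-nilpotent g μ≤K A B C →
    let open FiniteValuationRing R in
    1/u*[m⊓n/d]≤p (4 * K) (q ^ r * ∣ B ∣ₓ) (∣ A ∣ₓ * ∣ B ∣ₓ ^ 2 * ∣ C ∣ₓ) (q ^ (2 * r ∸ 1))
      (∣ f[_,_] g A B ∣ * ∣ B · C ∣)
      {{_}} {{m^n≢0 q (2 * r ∸ 1) {{residue-nonZero commutativeRing residue}}}}
      (Incidence.image-product-bound R {z} z-uniformizer {r} {q} z-nilpotent residue g A B C 1≤K μ≤K)
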